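{- With respect to the class of all frames that are forward, backward, downward and upward confluent, the class of all reflexive frames is not modally definable.
   Context: Syntax. $\mathbf{At}=\{p_i : i\in\mathbb{N}\}$ is a countable set of atoms (enumerated without repetition). The set $\mathbf{Fo}$ of formulas is generated by $A ::= p \mid (A\rightharpoonup A)\mid (A\leftharpoondown A)\mid \top\mid\bot\mid (A\vee A)\mid (A\wedge A)\mid \lozenge A\mid\square A\mid⧫ A\mid\blacksquare A$, with $p\in\mathbf{At}$. A signed formula is a pair $(\alpha,A)$ with $\alpha\in\{+,-\}$ and $A\in\mathbf{Fo}$. Semantics. A frame is a triple $(W,\leq,R)$ where $W\neq\emptyset$, $\leq$ is a preorder on $W$ and $R$ is a binary relation on $W$; $\geq$ is the converse of $\leq$. A valuation is a function $V:\mathbf{At}\to\wp(W)$ such that each $V(p)$ is $\leq$-closed (if $s\in V(p)$ and $s\leq t$ then $t\in V(p)$). A model based on $(W,\leq,R)$ is $(W,\leq,R,V)$ with $V$ a valuation. Satisfaction at $s\in W$: $s\models p$ iff $s\in V(p)$; $s\models\top$; $s\not\models\bot$; $\vee,\wedge$ as usual pointwise; - $s\models A\rightharpoonup B$ iff for all $t\geq s$, $t\not\models A$ or $t\models B$; - $s\models A\leftharpoondown B$ iff there is $t\leq s$ with $t\not\models A$ and $t\models B$; - $s\models\lozenge A$ iff there are $t\leq s$ and $u$ with $tRu$ and $u\models A$; - $s\models\square A$ iff for all $t\geq s$ and all $u$, $tRu$ implies $u\models A$; - $s\models⧫ A$ iff for all $t\geq s$ there is $u$ with $tRu$ and $u\models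 A$; - $s\models\blacksquare A$ iff there is $t\leq s$ such that for all $u$, $tRu$ implies $u\models A$. Further, $s\models(+,A)$ iff $s\models A$, and $s\models(-,A)$ iff $s\not\models A$. A signed formula is valid in a frame if it is satisfied at every point of every model based on the frame. Composition: $s(R\circ S)t$ iff there is $u$ with $sRu$ and $uSt$. A frame is forward confluent if ${\geq}\circ R\subseteq R\circ{\geq}$; backward confluent if $R\circ{\leq}\subseteq{\leq}\circ R$; downward confluent if ${\leq}\circ R\subseteq R\circ{\leq}$; upward confluent if $R\circ{\geq}\subseteq{\geq}\circ R$; reflexive if $sRs$ for all $s\in W$. Definability. An inference rule consists of $m\in\mathbb{N}$ signed formulas $(\alpha_1,A_1),\dots,(\alpha_m,A_m)$ (premises) and a signed formula $(\beta,B)$ (conclusion). A frame respects the rule if: whenever all premises are valid in the frame, the conclusion is valid in the frame. A class $\mathcal{C}$ of frames is modally definable with respect to a class $\mathcal{D}$ of frames if there is an inference rule such that every frame in $\mathcal{D}$ respects the rule iff it is in $\mathcal{C}$. -}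

module Defs where

open import Data.Empty as Empty using ()
open import Data.List.Base using (List)
open import Data.List.Relation.Unary.All using (All)
open import Data.Nat.Base using (ℕ)
open import Data.Product.Base using (_×_; _,_; ∃; ∃₂)
open import Data.Sign.Base using (Sign)
open import Data.Sum.Base using (_⊎_)
open import Data.Unit.Base as Unit using ()
open import Function.Base using (flip)
open import Function.Bundles using (_⇔_)
open import Level using (Level; 0ℓ; suc; _⊔_)
open import Relation.Binary.Construct.Composition using () renaming (_;_ to _⨾_)
open import Relation.Binary.Core using (Rel; _⇒_)
open import Relation.Binary.Definitions using (Reflexive; _Respects_)
open import Relation.Binary.PropositionalEquality.Core using (_≡_)
open import Relation.Binary.Structures using (IsPreorder)
open import Relation.Nullary.Negation.Core using (¬_)
open import Relation.Unary using (Pred; _∩_)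

private
  variable
    c d : Level

-- The atom pᵢ is represented by its index i.
At : Set
At = ℕ

infixr 5 _⇀_
infixr 5 _↽_
infixr 6 _∨_
infixr 7 _∧_
infix  8 ◇_ □_ ⧫_ ■_

data Fo : Set where
  atom    : At → Fo
  _⇀_ _↽_ : Fo → Fo → Fo
  ⊤ ⊥     : Fo
  _∨_ _∧_ : Fo → Fo → Fo
  ◇_ □_   : Fo → Fo
  ⧫_ ■_   : Fo → Fo

SignedFo : Set
SignedFo = Sign × Fo

record Frame : Set₁ where
  infix 4 _≤_ _≥_ _R_
  field
    W          : Set
    nonempty   : W
    _≤_        : Rel W 0ℓ
    isPreorder : IsPreorder _≡_ _≤_
    _R_        : Rel W 0ℓ

  _≥_ : Rel W 0ℓ
  _≥_ = flip _≤_

record Valuation (F : Frame) : Set₁ where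
  open Frame F
  field
    V      : At → Pred W 0ℓ
    closed : ∀ p → V p Respects _≤_

-- The clauses of _⊨_ are those of the classical semantics, read as types; in
-- particular the clause for _⇀_ is a disjunction, not a function type. Under
-- excluded middle this is the usual satisfaction relation on subsets of W.
module Semantics {F : Frame} (M : Valuation F) where
  open Frame F
  open Valuation M

  infix 4 _⊨_ _⊭_ _⊨ˢ_

  _⊨_ _⊭_ : W → Fo → Set
  s ⊨ atom p = V p s
  s ⊨ A ⇀ B  = ∀ t → t ≥ s → t ⊭ A ⊎ t ⊨ B
  s ⊨ A ↽ B  = ∃ λ t → t ≤ s × t ⊭ A × t ⊨ B
  s ⊨ ⊤      = Unit.⊤
  s ⊨ ⊥      = Empty.⊥
  s ⊨ A ∨ B  = s ⊨ A ⊎ s ⊨ B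
  s ⊨ A ∧ B  = s ⊨ A × s ⊨ B
  s ⊨ ◇ A    = ∃₂ λ t u → t ≤ s × t R u × u ⊨ A
  s ⊨ □ A    = ∀ t → t ≥ s → ∀ u → t R u → u ⊨ A
  s ⊨ ⧫ A    = ∀ t → t ≥ s → ∃ λ u → t R u × u ⊨ A
  s ⊨ ■ A    = ∃ λ t → t ≤ s × (∀ u → t R u → u ⊨ A)

  s ⊭ A = ¬ (s ⊨ A)

  _⊨ˢ_ : W → SignedFo → Set
  s ⊨ˢ (Sign.+ , A) = s ⊨ A
  s ⊨ˢ (Sign.- , A) = s ⊭ A

Valid : Frame → SignedFo → Set₁
Valid F φ = (M : Valuation F) → ∀ s → Semantics._⊨ˢ_ M s φ

module _ (F : Frame) where
  open Frame F

  ForwardConfluent : Set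
  ForwardConfluent = (_≥_ ⨾ _R_) ⇒ (_R_ ⨾ _≥_)

  BackwardConfluent : Set
  BackwardConfluent = (_R_ ⨾ _≤_) ⇒ (_≤_ ⨾ _R_)

  DownwardConfluent : Set
  DownwardConfluent = (_≤_ ⨾ _R_) ⇒ (_R_ ⨾ _≤_)

  UpwardConfluent : Set
  UpwardConfluent = (_R_ ⨾ _≥_) ⇒ (_≥_ ⨾ _R_)

  ReflexiveFrame : Set
  ReflexiveFrame = Reflexive _R_

record Rule : Set where
  field
    premises   : List SignedFo
    conclusion : SignedFo

RespectsRule : Frame → Rule → Set₁
RespectsRule F r = All (Valid F) premises → Valid F conclusion
  where open Rule r

FrameClass : (c : Level) → Set (suc 0ℓ ⊔ suc c)
FrameClass c = Pred Frame c

ModallyDefinable_WithRespectTo_ : FrameClass c → FrameClass d → Set (suc 0ℓ ⊔ c ⊔ d)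
ModallyDefinable C WithRespectTo D =
  ∃ λ (r : Rule) → ∀ F → D F → (RespectsRule F r ⇔ C F)

FBDUConfluent : FrameClass 0ℓ
FBDUConfluent =
  ForwardConfluent ∩ BackwardConfluent ∩ DownwardConfluent ∩ UpwardConfluent

{-# OPTIONS --safe #-}

-- When ≤ relates every two points, valuations are constant on the frame. If
-- moreover R is serial, each of ◇, □, ⧫ and ■ acts as the identity on the
-- resulting truth values, so that validity does not depend on R. The identity
-- and the swap on two points thus yield frames that respect the same rules,
-- although only the first is reflexive.

module Submission where

open import Defs
open import Data.Bool.Base using (Bool; false; not)
open import Data.Bool.Properties using (not-involutive)
open import Data.List.Relation.Unary.All as All using ()
open import Data.Product.Base using (∃; _,_; proj₂)
open import Data.Sign.Base using (Sign)
open import Data.Sum.Base as Sum using ()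
open import Data.Unit.Base as Unit using ()
open import Function.Base using (_∘_; flip)
open import Function.Bundles using (module Equivalence)
open import Level using (0ℓ)
open import Relation.Binary.Core using (Rel)
open import Relation.Binary.PropositionalEquality.Core using (_≡_; refl)
open import Relation.Binary.PropositionalEquality.Properties using (isEquivalence)
open import Relation.Nullary.Negation.Core using (¬_; contradiction)

Serial : {W : Set} → Rel W 0ℓ → Set
Serial R = ∀ x → ∃ (R x)

module _ {W : Set} (w : W) where

  indiscrete : Rel W 0ℓ → Frame
  indiscrete R = record
    { W          = W
    ; nonempty   = w
    ; _≤_        = λ _ _ → Unit.⊤
    ; isPreorder = record { isEquivalence = isEquivalence }
    ; _R_        = R
    }

  -- Since `≤` is total, a composite asks only for an `R`-edge: out of the source for forward and
  -- downward confluence, into the target for the other two.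
  indiscrete-confluent : {R : Rel W 0ℓ} → Serial R → Serial (flip R) →
                         FBDUConfluent (indiscrete R)
  indiscrete-confluent ser ser⁻¹ =
    (λ {x} _ → let y , xRy = ser x in y , xRy , _) ,
    (λ {_} {z} _ → let y , yRz = ser⁻¹ z in y , _ , yRz) ,
    (λ {x} _ → let y , xRy = ser x in y , xRy , _) ,
    (λ {_} {z} _ → let y , yRz = ser⁻¹ z in y , _ , yRz)

  transport : {R S : Rel W 0ℓ} → Valuation (indiscrete R) → Valuation (indiscrete S)
  transport M = record { V = V ; closed = closed }
    where open Valuation M

  -- Taking S = R shows that truth is constant. The negative occurrences in ⇀ and
  -- ↽ use the statement with R and S exchanged.
  ⊨-transport : {R S : Rel W 0ℓ} → Serial R → Serial S →
                (M : Valuation (indiscrete R)) → ∀ A {s t} →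
                Semantics._⊨_ M s A → Semantics._⊨_ (transport {S = S} M) t A
  ⊨-transport {R} {S} serR serS M = go
    where
    open Semantics M using (_⊨_)
    open Semantics (transport {S = S} M) using () renaming (_⊨_ to _⊨′_)

    -- By record eta, `transport (transport M)` is `M` itself.
    back : ∀ A {s t} → s ⊨′ A → t ⊨ A
    back = ⊨-transport serS serR (transport M)

    go : ∀ A {s t} → s ⊨ A → t ⊨′ A
    go (atom p)        = Valuation.closed M p _
    go (A ⇀ B) {s} f   = λ _ _ → Sum.map (_∘ back A) (go B) (f s _)
    go (A ↽ B) {t = t} (_ , _ , ⊭A , ⊨B) = t , _ , ⊭A ∘ back A , go B ⊨B
    go ⊤       _       = _
    go (A ∨ B)         = Sum.map (go A) (go B)
    go (A ∧ B) (a , b) = go A a , go B b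
    go (◇ A) {t = t} (_ , _ , _ , _ , a) =
      let u , tSu = serS t in t , u , _ , tSu , go A a
    -- Seriality of `R` keeps the universal hypothesis from being vacuous: one successor satisfying
    -- `A` is enough, as `go` reaches every point from it.
    go (□ A) {s} f     = λ _ _ _ _ → let u , sRu = serR s in go A (f s _ u sRu)
    go (⧫ A) {s} f     = λ t _ →
      let u , tSu = serS t in u , tSu , go A (proj₂ (proj₂ (f s _)))
    go (■ A) {t = t} (r , _ , f) =
      t , _ , λ _ _ → let u , rRu = serR r in go A (f u rRu)

  -- A valuation for `S` is also one for `R`, so validity over `R` applies to it. The sign `-`
  -- reverses the direction in which truth is carried.
  Valid-transport : {R S : Rel W 0ℓ} → Serial R → Serial S → ∀ φ →
                    Valid (indiscrete R) φ → Valid (indiscrete S) φ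
  Valid-transport serR serS (Sign.+ , A) valid M s =
    ⊨-transport serR serS (transport M) A (valid (transport M) s)
  Valid-transport serR serS (Sign.- , A) valid M s =
    valid (transport M) s ∘ ⊨-transport serS serR M A

  RespectsRule-transport : {R S : Rel W 0ℓ} → Serial R → Serial S → ∀ r →
                           RespectsRule (indiscrete R) r →
                           RespectsRule (indiscrete S) r
  RespectsRule-transport serR serS r respects =
    Valid-transport serR serS conclusion ∘ respects ∘
    All.map (λ {φ} → Valid-transport serS serR φ)
    where open Rule r

-- The graph of a bijection without fixed points: serial both ways, yet irreflexive.
Swap : Rel Bool 0ℓ
Swap x y = not x ≡ y

≡-serial : Serial {Bool} _≡_
≡-serial x = x , refl

≡-serial⁻¹ : Serial {Bool} (flip _≡_)
≡-serial⁻¹ x = x , refl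

Swap-serial : Serial Swap
Swap-serial x = not x , refl

Swap-serial⁻¹ : Serial (flip Swap)
Swap-serial⁻¹ x = not x , not-involutive x

proposition26 : ¬ (ModallyDefinable ReflexiveFrame WithRespectTo FBDUConfluent)
-- Reflexivity at `false` would read `not false ≡ false`.
proposition26 (r , defines) = contradiction (swap-reflexive {false}) λ ()
  where
  open Equivalence

  ≡-respects : RespectsRule (indiscrete false _≡_) r
  ≡-respects =
    defines _ (indiscrete-confluent false ≡-serial ≡-serial⁻¹) .from refl

  swap-reflexive : ReflexiveFrame (indiscrete false Swap)
  swap-reflexive =
    defines _ (indiscrete-confluent false Swap-serial Swap-serial⁻¹) .to
      (RespectsRule-transport false ≡-serial Swap-serial r ≡-respects)
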